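{- For integers $n,m,l,r$ with $1\leq m\leq l<n$ and $0\leq r\leq 2l-2m+2$, the polynomial \[ K_q(n,m)K_q(n,l)-q^{r}K_q(n,m-1)K_q(n,l+1) \] has nonnegative coefficients as a polynomial in $q$.
   Context: For integers $n\ge m\ge 0$ the Gaussian polynomial is ${n\brack m}=\prod_{i=0}^{m-1}\frac{1-q^{n-i}}{1-q^{m-i}}$. For $n\geq 1$ and $0\le m\le n$, the $q$-Kaplansky number is $K_q(n,m)=\frac{1-q^{n+m}}{1-q^{n}}{n\brack m}$ (a polynomial in $q$). -}

module Defs where

open import Data.Bool.Base using (if_then_else_)
open import Data.Fin.Base using (Fin; toℕ)
open import Data.Fin.Properties using (toℕ<n)
open import Data.Integer.Base using (ℤ; 0ℤ; 1ℤ; _-_; _*_; _≤_)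
open import Data.Integer.Properties using (+-0-commutativeMonoid)
open import Data.Nat.Base as ℕ using (ℕ; suc; _∸_; NonZero)
open import Data.Nat.Divisibility using (_∣?_)
open import Data.Nat.Properties using (m<n⇒0<n∸m; _≟_)
open import Data.Product.Base using (∃-syntax; _×_)
open import Data.Vec.Functional using (foldr)
open import Relation.Binary.PropositionalEquality.Core using (_≡_)
open import Relation.Nullary.Decidable.Core using (does)

open import Algebra.Properties.CommutativeMonoid.Sum +-0-commutativeMonoid
  using (sum)

-- The quotients occurring below have denominators that are products of factors
-- 1 - q^k with k ≥ 1.  These are units of ℤ[[q]], so we compute in ℤ[[q]], into
-- which the rational functions with such denominators (and in particular the
-- polynomials) embed.  A series is given by its coefficients.
Series : Set
Series = ℕ → ℤ

infixl 7 _⊗_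
infixl 6 _⊖_

_⊖_ : Series → Series → Series
(f ⊖ g) i = f i - g i

_⊗_ : Series → Series → Series
(f ⊗ g) i = sum {suc i} (λ j → f (toℕ j) * g (i ∸ toℕ j))

q^_ : ℕ → Series
(q^ k) i = if does (i ≟ k) then 1ℤ else 0ℤ

𝟙 : Series
𝟙 = q^ 0

∏ : ∀ {m} → (Fin m → Series) → Series
∏ = foldr _⊗_ 𝟙

1-q^_ : ℕ → Series
1-q^ k = 𝟙 ⊖ q^ k

-- (1 - q^k)⁻¹ = 1 + q^k + q^(2k) + ⋯, which requires k ≥ 1.
[1-q^_]⁻¹ : (k : ℕ) .{{_ : NonZero k}} → Series
[1-q^ k ]⁻¹ i = if does (k ∣? i) then 1ℤ else 0ℤ

-- Meaningful for m ≤ n only: otherwise the truncated exponents n ∸ i are not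
-- those of the formula.
gaussian : ℕ → ℕ → Series
gaussian n m = ∏ {m} λ i →
  (1-q^ (n ∸ toℕ i)) ⊗ [1-q^ (m ∸ toℕ i) ]⁻¹ {{ℕ.>-nonZero (m<n⇒0<n∸m (toℕ<n i))}}

Kq : (n : ℕ) .{{_ : NonZero n}} → ℕ → Series
Kq n m = (1-q^ (n ℕ.+ m)) ⊗ [1-q^ n ]⁻¹ ⊗ gaussian n m

IsPolynomial : Series → Set
IsPolynomial f = ∃[ d ] ∀ i → d ℕ.< i → f i ≡ 0ℤ

IsNonNegPolynomial : Series → Set
IsNonNegPolynomial f = IsPolynomial f × (∀ i → 0ℤ ≤ f i)

{-# OPTIONS --safe #-}
module Submission where

open import Defs
open import Data.Nat.Base using (ℕ; _+_; _*_; _∸_; _≤_; _<_; NonZero)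

-- With G a b = [a+b, a] and ≼ the coefficientwise order, the exchange inequality
--   q^r G(a, g+c+b) G(a+d, b) ≼ G(a, c+b) G(a+d, g+b)      (r ≤ d g)
-- follows from Pascal's rule by induction, together with the companion
--   q^(r+c) G(a, g+c+b) G(a+1+d, b) ≼ G(a+1, c+b) G(a+d, g+b)  (r ≤ d g).
-- Applying it once to the boxes and once to the transposed boxes compares
-- [n,m-1][n,l+1] with [n,m][n,l], and likewise for shifted indices.
-- A Kaplansky number is both [n,m] + q^n [n-1,m-1] and q^m [n,m] + [n-1,m-1].
-- The first form if r ≤ l-m+1, the second one if r ≥ l-m+1, reduces the claim
-- to four such comparisons, one for each term of the expanded product.

open import Algebra.Bundles using (CommutativeRing)
import Algebra.Consequences.Setoid as Consequences
import Algebra.Properties.Ring as RingProperties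
import Algebra.Solver.Ring.NaturalCoefficients.Default as SemiringSolver
open import Data.Bool.Base using (if_then_else_)
open import Data.Integer.Base as ℤ using (ℤ; 0ℤ; 1ℤ; +≤+)
import Data.Integer.Properties as ℤ
open import Data.Integer.Solver using () renaming (module +-*-Solver to ℤ-Solver)
open import Data.Nat.Base using (zero; suc; z≤n; s≤s; s<s)
open import Data.Nat.Divisibility using (_∣?_; _∣0; ∣m+n∣m⇒∣n; ∣-refl; ∣m∣n⇒∣m+n; ∣⇒≤)
import Data.Nat.Properties as ℕ
open import Data.Nat.Solver using () renaming (module +-*-Solver to ℕ-Solver)
open import Data.Product.Base using (∃-syntax; _×_; _,_)
open import Data.Sum.Base using (inj₁; inj₂)
open import Function.Base using (_∘_; _$_)
open import Function.Bundles using (mk⇔)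
open import Relation.Binary.Bundles using (Preorder; Setoid)
open import Relation.Binary.PropositionalEquality
  using (_≡_; refl; sym; trans; cong; cong₂; subst; module ≡-Reasoning)
open import Relation.Binary.Structures using (IsEquivalence; IsPreorder)
open import Relation.Nullary.Decidable using (yes; no; dec-true; dec-false; does-⇔)

-- Ordered commutative rings with powers of q.

-- Working over an abstract ring keeps Agda from unfolding the convolutions.
record OrderedRingWithPowers : Set₁ where
  infix 4 _≼_
  field
    commutativeRing : CommutativeRing _ _
  open CommutativeRing commutativeRing public
    renaming (_+_ to _⊞_; _*_ to _·_; refl to ≈-refl; sym to ≈-sym; trans to ≈-trans)
    using (Carrier; _≈_; 0#; 1#; setoid; ring; commutativeSemiring;
           +-cong; +-congˡ; +-congʳ; +-comm; +-identityˡ; +-identityʳ;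
           *-cong; *-congˡ; *-congʳ; *-assoc; *-comm; *-identityˡ; zeroˡ; zeroʳ)
  field
    _≼_          : Carrier → Carrier → Set
    ≼-isPreorder : IsPreorder _≈_ _≼_
    ⊞-mono       : ∀ {f f′ g g′} → f ≼ f′ → g ≼ g′ → f ⊞ g ≼ f′ ⊞ g′
    ·-monoʳ      : ∀ {x f g} → 0# ≼ x → f ≼ g → x · f ≼ x · g
    q↑_          : ℕ → Carrier
    q↑-zero      : q↑ 0 ≈ 1#
    q↑-+         : ∀ m n → q↑ (m + n) ≈ q↑ m · q↑ n
    q↑-nonNeg    : ∀ k → 0# ≼ q↑ k

  ≼-preorder : Preorder _ _ _
  ≼-preorder = record { isPreorder = ≼-isPreorder }

-- Arithmetic of exponents.

split-≤ : ∀ m n {r} → r ≤ m + n → ∃[ s ] ∃[ t ] s + t ≡ r × s ≤ m × t ≤ n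
split-≤ m n {r} r≤m+n with ℕ.≤-total r m
... | inj₁ r≤m = r , 0 , ℕ.+-identityʳ r , r≤m , z≤n
... | inj₂ m≤r with t , refl ← ℕ.m≤n⇒∃[o]m+o≡n m≤r =
  m , t , refl , ℕ.≤-refl , ℕ.+-cancelˡ-≤ m _ _ r≤m+n

module ExponentIdentities where
  open ℕ-Solver

  n≡ : ∀ m e j → 0 + (2 + e + m + j) ≡ suc m + (suc e + j) + 0
  n≡ = solve 3 (λ m e j → con 2 :+ e :+ m :+ j := con 1 :+ m :+ (con 1 :+ e :+ j) :+ con 0) refl

  n≡′ : ∀ m e j → m + (2 + e + j) + 0 ≡ 0 + (suc e + m + suc j)
  n≡′ = solve 3 (λ m e j → m :+ (con 2 :+ e :+ j) :+ con 0 := con 1 :+ e :+ m :+ (con 1 :+ j)) refl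

  2n≡ : ∀ m e j → m + (2 + e + j) + (2 + e + m + j) ≡ suc m + (suc e + j) + (suc e + m + suc j)
  2n≡ = solve 3 (λ m e j → m :+ (con 2 :+ e :+ j) :+ (con 2 :+ e :+ m :+ j)
    := con 1 :+ m :+ (con 1 :+ e :+ j) :+ (con 1 :+ e :+ m :+ (con 1 :+ j))) refl

  m+l≡ : ∀ m e → m + (2 + e + m) ≡ suc m + (suc e + m)
  m+l≡ = solve 2 (λ m e → m :+ (con 2 :+ e :+ m) := con 1 :+ m :+ (con 1 :+ e :+ m)) refl

  m-shift : ∀ t m e → suc e + t + (m + 0) ≡ t + (0 + (suc e + m))
  m-shift = solve 3 (λ t m e → con 1 :+ e :+ t :+ (m :+ con 0) := t :+ (con 1 :+ e :+ m)) refl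

  l-shift : ∀ r m e → r + (0 + (2 + e + m)) ≡ r + suc e + (suc m + 0)
  l-shift = solve 3 (λ r m e → r :+ (con 2 :+ e :+ m) := r :+ (con 1 :+ e) :+ (con 1 :+ m :+ con 0)) refl

  -- The `range` identities relate the range 2e + 2 of r to the bounds of `balance` at h = 0, 1, 2,
  -- which are e + 1, 2e + 2 and 3e + 3.
  range₀ : ∀ e → 2 * e + 2 ≡ suc e + suc e
  range₀ = solve 1 (λ e → con 2 :* e :+ con 2 := con 1 :+ e :+ (con 1 :+ e)) refl

  range₁ : ∀ e → 2 * e + 2 ≡ (1 + suc e) + e * 1
  range₁ = solve 1 (λ e → con 2 :* e :+ con 2 := con 2 :+ e :+ e :* con 1) refl

  range₂ : ∀ e → 2 * e + 2 + suc e ≡ (2 + suc e) + e * 2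
  range₂ = solve 1 (λ e → con 2 :* e :+ con 2 :+ (con 1 :+ e) := con 3 :+ e :+ e :* con 2) refl

-- Gaussian polynomials: Pascal rules, absorption and symmetry.

module Gaussian (Q : OrderedRingWithPowers) where
  open OrderedRingWithPowers Q
  open IsPreorder ≼-isPreorder using ()
    renaming (refl to ≼-refl; trans to ≼-trans; reflexive to ≼-reflexive)
  open RingProperties ring using (+-cancelʳ)
  open SemiringSolver commutativeSemiring using (solve; _:=_; _:+_; _:*_)
  module ≈-Reasoning where
    open import Relation.Binary.Reasoning.Setoid setoid public
  module ≼-Reasoning where
    open import Relation.Binary.Reasoning.Preorder ≼-preorder public

  q↑-cong : ∀ {m n} → m ≡ n → q↑ m ≈ q↑ n
  q↑-cong refl = ≈-refl

  ·-monoˡ : ∀ {x f g} → 0# ≼ x → f ≼ g → f · x ≼ g · x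
  ·-monoˡ {x} {f} {g} 0≼x f≼g = begin
    f · x ≈⟨ *-comm f x ⟩
    x · f ≲⟨ ·-monoʳ 0≼x f≼g ⟩
    x · g ≈⟨ *-comm x g ⟩
    g · x ∎
    where open ≼-Reasoning

  ⊞-nonNeg : ∀ {f g} → 0# ≼ f → 0# ≼ g → 0# ≼ f ⊞ g
  ⊞-nonNeg 0≼f 0≼g = ≼-trans (≼-reflexive (≈-sym (+-identityˡ 0#))) (⊞-mono 0≼f 0≼g)

  ·-nonNeg : ∀ {f g} → 0# ≼ f → 0# ≼ g → 0# ≼ f · g
  ·-nonNeg {f} 0≼f 0≼g = ≼-trans (≼-reflexive (≈-sym (zeroʳ f))) (·-monoʳ 0≼f 0≼g)

  ≼-⊞ˡ : ∀ {f g} → 0# ≼ f → g ≼ f ⊞ g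
  ≼-⊞ˡ {f} {g} 0≼f = ≼-trans (≼-reflexive (≈-sym (+-identityˡ g))) (⊞-mono 0≼f ≼-refl)

  ≼-⊞ʳ : ∀ {f g} → 0# ≼ g → f ≼ f ⊞ g
  ≼-⊞ʳ {f} {g} 0≼g = ≼-trans (≼-reflexive (≈-sym (+-identityʳ f))) (⊞-mono ≼-refl 0≼g)

  1-nonNeg : 0# ≼ 1#
  1-nonNeg = ≼-trans (q↑-nonNeg 0) (≼-reflexive q↑-zero)

  -- The Gaussian polynomial [a+b, a], counting partitions in an a × b box.
  G : ℕ → ℕ → Carrier
  G zero    b       = 1#
  G (suc a) zero    = 1#
  G (suc a) (suc b) = q↑ suc b · G a (suc b) ⊞ G (suc a) b

  q↑0· : ∀ f → q↑ 0 · f ≈ f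
  q↑0· f = ≈-trans (*-congʳ q↑-zero) (*-identityˡ f)

  G-congˡ : ∀ {a a′} b → a ≡ a′ → G a b ≈ G a′ b
  G-congˡ b refl = ≈-refl

  G-zeroʳ : ∀ a → G a 0 ≈ 1#
  G-zeroʳ zero    = ≈-refl
  G-zeroʳ (suc a) = ≈-refl

  -- The absorption identity (1 - q^(a+1)) G(a+1, b) = (1 - q^(a+1+b)) G(a, b) and its mirror image,
  -- free of subtraction. One induction proves all three: `pascalʳ a b` rests on the absorptions at
  -- (a, b) and yields `absorbˡ a (suc b)` and `absorbʳ (suc a) b`.
  absorbˡ : ∀ a b → G (suc a) b ⊞ q↑ (suc a + b) · G a b ≈ q↑ suc a · G (suc a) b ⊞ G a b
  absorbʳ : ∀ a b → G a (suc b) ⊞ q↑ (suc a + b) · G a b ≈ q↑ suc b · G a (suc b) ⊞ G a b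
  pascalʳ : ∀ a b → G (suc a) (suc b) ≈ q↑ suc a · G (suc a) b ⊞ G a (suc b)

  absorbˡ a zero = begin
    1# ⊞ q↑ (suc a + 0) · G a 0
      ≈⟨ +-cong (≈-sym (G-zeroʳ a)) (*-cong (q↑-cong (ℕ.+-identityʳ (suc a))) (G-zeroʳ a)) ⟩
    G a 0 ⊞ q↑ suc a · 1#
      ≈⟨ +-comm _ _ ⟩
    q↑ suc a · 1# ⊞ G a 0 ∎
    where open ≈-Reasoning
  absorbˡ a (suc b) = begin
    G (suc a) (suc b) ⊞ q↑ (suc a + suc b) · y  ≈⟨ +-cong (pascalʳ a b) (*-congʳ (q↑-+ (suc a) (suc b))) ⟩
    (u · x ⊞ y) ⊞ (u · v) · y                   ≈⟨ solve 4 (λ u v x y → (u :* x :+ y) :+ (u :* v) :* y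
                                                     := u :* (v :* y :+ x) :+ y) ≈-refl u v x y ⟩
    u · (v · y ⊞ x) ⊞ y                         ∎
    where
    open ≈-Reasoning
    u = q↑ suc a
    v = q↑ suc b
    x = G (suc a) b
    y = G a (suc b)

  absorbʳ zero    b = +-comm _ _
  absorbʳ (suc a) b = begin
    (v · y ⊞ x) ⊞ q↑ (2 + a + b) · x    ≈⟨ +-congˡ (*-congʳ (q↑-cong (ℕ.+-suc (suc a) b))) ⟨
    (v · y ⊞ x) ⊞ q↑ (suc a + suc b) · x  ≈⟨ +-congˡ (*-congʳ (q↑-+ (suc a) (suc b))) ⟩
    (v · y ⊞ x) ⊞ (u · v) · x           ≈⟨ solve 4 (λ u v x y → (v :* y :+ x) :+ (u :* v) :* x
                                             := v :* (u :* x :+ y) :+ x) ≈-refl u v x y ⟩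
    v · (u · x ⊞ y) ⊞ x                 ≈⟨ +-congʳ (*-congˡ (≈-sym (pascalʳ a b))) ⟩
    v · G (suc a) (suc b) ⊞ x           ∎
    where
    open ≈-Reasoning
    u = q↑ suc a
    v = q↑ suc b
    x = G (suc a) b
    y = G a (suc b)

  -- The absorptions read x + t = x′ + g and y + t = y′ + g; their difference is x - y = x′ - y′.
  pascalʳ a b = +-cancelʳ (t ⊞ g) _ _ (begin
    (y′ ⊞ x) ⊞ (t ⊞ g)  ≈⟨ solve 4 (λ y′ x t g → (y′ :+ x) :+ (t :+ g) := (x :+ t) :+ (y′ :+ g)) ≈-refl y′ x t g ⟩
    (x ⊞ t) ⊞ (y′ ⊞ g)  ≈⟨ +-cong (absorbˡ a b) (≈-sym (absorbʳ a b)) ⟩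
    (x′ ⊞ g) ⊞ (y ⊞ t)  ≈⟨ solve 4 (λ x′ y t g → (x′ :+ g) :+ (y :+ t) := (x′ :+ y) :+ (t :+ g)) ≈-refl x′ y t g ⟩
    (x′ ⊞ y) ⊞ (t ⊞ g)  ∎)
    where
    open ≈-Reasoning
    x = G (suc a) b
    y = G a (suc b)
    g = G a b
    t = q↑ (suc a + b) · g
    x′ = q↑ suc a · x
    y′ = q↑ suc b · y

  -- Transposing the box turns the defining Pascal rule into `pascalʳ`.
  G-sym : ∀ a b → G a b ≈ G b a
  G-sym zero    b       = ≈-sym (G-zeroʳ b)
  G-sym (suc a) zero    = ≈-refl
  G-sym (suc a) (suc b) = begin
    q↑ suc b · G a (suc b) ⊞ G (suc a) b  ≈⟨ +-cong (*-congˡ (G-sym a (suc b))) (G-sym (suc a) b) ⟩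
    q↑ suc b · G (suc b) a ⊞ G b (suc a)  ≈⟨ pascalʳ b a ⟨
    G (suc b) (suc a)                     ∎
    where open ≈-Reasoning

  G-nonNeg : ∀ a b → 0# ≼ G a b
  G-nonNeg zero    b       = 1-nonNeg
  G-nonNeg (suc a) zero    = 1-nonNeg
  G-nonNeg (suc a) (suc b) =
    ⊞-nonNeg (·-nonNeg (q↑-nonNeg (suc b)) (G-nonNeg a (suc b))) (G-nonNeg (suc a) b)

  G-monoʳ : ∀ a b → G a b ≼ G a (suc b)
  G-monoʳ zero    b = ≼-refl
  G-monoʳ (suc a) b = ≼-⊞ˡ (·-nonNeg (q↑-nonNeg (suc b)) (G-nonNeg a (suc b)))

  q↑·G≼G : ∀ a b → q↑ b · G a b ≼ G (suc a) b
  q↑·G≼G a zero    = ≼-reflexive (≈-trans (*-cong q↑-zero (G-zeroʳ a)) (*-identityˡ 1#))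
  q↑·G≼G a (suc b) = ≼-⊞ʳ (G-nonNeg (suc a) b)

  -- The exchange inequality.

  -- If g ≤ r and d ≥ 1, Pascal's rule for both factors with first index a + d
  -- reduces to (b - 1, c + 1) and to (d - 1, r - g).  Otherwise r ≤ d (g - 1), and the
  -- rule for G a (g + _) and G (a + d) (g + b) reduces to g - 1 and to exchange′.
  exchange : ∀ a d b c g {r} → r ≤ d * g →
             q↑ r · (G a (g + (c + b)) · G (a + d) b) ≼ G a (c + b) · G (a + d) (g + b)
  -- This compares the first Pascal summands in `exchange-low`: their weights q^(g+1+c+b) and
  -- q^(g+1+b) differ by `q↑ c`. The recursion ends although g may grow: `exchange-low` calls
  -- `exchange′` only at a smaller a, `exchange′` lowers b or falls back to `exchange` at the same
  -- a, and `exchange` otherwise lowers d, b or g.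
  exchange′ : ∀ a d b c g {r} → r ≤ d * g →
              q↑ r · (q↑ c · (G a (g + (c + b)) · G (suc a + d) b))
              ≼ G (suc a) (c + b) · G (a + d) (g + b)
  exchange-low : ∀ a d b c g {r} → r ≤ d * g →
                 q↑ r · (G a (suc g + (c + b)) · G (a + d) b) ≼ G a (c + b) · G (a + d) (suc g + b)
  exchange-high : ∀ a d b c g r → r ≤ d * suc g →
                  q↑ (suc g + r) · (G a (suc g + (c + b)) · G (suc a + d) b)
                  ≼ G a (c + b) · G (suc a + d) (suc g + b)

  exchange a d b c zero r≤ rewrite ℕ.*-zeroʳ d with z≤n ← r≤ =
    ≼-reflexive (≈-trans (*-congʳ q↑-zero) (*-identityˡ _))
  exchange a zero    b c (suc g) r≤ = exchange-low a 0 b c g r≤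
  exchange a (suc d) b c (suc g) {r} r≤ with suc g ℕ.≤? r
  ... | yes g<r with r′ , refl ← ℕ.m≤n⇒∃[o]m+o≡n g<r rewrite ℕ.+-suc a d =
    exchange-high a d b c g r′ (ℕ.+-cancelˡ-≤ (suc g) _ _ r≤)
  ... | no g≮r = exchange-low a (suc d) b c g (ℕ.≤-trans (ℕ.≤-pred (ℕ.≰⇒> g≮r)) (ℕ.m≤m+n g (d * g)))

  exchange-low zero d b c g {r} r≤ = begin
    q↑ r · (1# · G d b)  ≲⟨ exchange 0 d b c g r≤ ⟩
    1# · G d (g + b)     ≲⟨ ·-monoʳ 1-nonNeg (G-monoʳ d (g + b)) ⟩
    1# · G d (suc g + b) ∎
    where open ≼-Reasoning
  exchange-low (suc a) d b c g {r} r≤ = begin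
    q↑ r · ((q↑ (suc g + (c + b)) · x ⊞ y) · z)
      ≈⟨ *-congˡ (*-congʳ (+-congʳ (*-congʳ (≈-trans (q↑-cong exponents) (q↑-+ (suc g + b) c))))) ⟩
    q↑ r · (((p · q↑ c) · x ⊞ y) · z)
      ≈⟨ solve 6 (λ r p c x y z → r :* (((p :* c) :* x :+ y) :* z)
                   := p :* (r :* (c :* (x :* z))) :+ r :* (y :* z)) ≈-refl (q↑ r) p (q↑ c) x y z ⟩
    p · (q↑ r · (q↑ c · (x · z))) ⊞ q↑ r · (y · z)
      ≲⟨ ⊞-mono (·-monoʳ (q↑-nonNeg (suc g + b))
                  (exchange′ a d b c (suc g) (ℕ.≤-trans r≤ (ℕ.*-monoʳ-≤ d (ℕ.n≤1+n g)))))
                (exchange (suc a) d b c g r≤) ⟩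
    p · (w · u) ⊞ w · v
      ≈⟨ solve 4 (λ p w u v → p :* (w :* u) :+ w :* v := w :* (p :* u :+ v)) ≈-refl p w u v ⟩
    w · (p · u ⊞ v) ∎
    where
    open ≼-Reasoning
    p = q↑ (suc g + b)
    x = G a (suc g + (c + b))
    y = G (suc a) (g + (c + b))
    z = G (suc a + d) b
    w = G (suc a) (c + b)
    u = G (a + d) (suc g + b)
    v = G (suc a + d) (g + b)
    exponents : suc g + (c + b) ≡ (suc g + b) + c
    exponents = cong suc (trans (cong (g +_) (ℕ.+-comm c b)) (sym (ℕ.+-assoc g b c)))

  -- For b = 0 both `G (suc a + d) 0` and `G (a + d) 0` are 1, and the first Pascal summand on the
  -- right already dominates.
  exchange-high a d zero c g r r≤ = begin
    q↑ (suc g + r) · (x · 1#)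
      ≈⟨ *-cong (q↑-+ (suc g) r) (*-congˡ (≈-sym (G-zeroʳ (a + d)))) ⟩
    (q↑ suc g · q↑ r) · (x · G (a + d) 0)
      ≈⟨ solve 3 (λ p r y → (p :* r) :* y := p :* (r :* y)) ≈-refl (q↑ suc g) (q↑ r) (x · G (a + d) 0) ⟩
    q↑ suc g · (q↑ r · (x · G (a + d) 0))
      ≲⟨ ·-monoʳ (q↑-nonNeg (suc g)) (exchange a d 0 c (suc g) r≤) ⟩
    q↑ suc g · (w · u)
      ≈⟨ *-congʳ (q↑-cong (sym (ℕ.+-identityʳ (suc g)))) ⟩
    q↑ (suc g + 0) · (w · u)
      ≈⟨ solve 3 (λ p w u → p :* (w :* u) := w :* (p :* u)) ≈-refl (q↑ (suc g + 0)) w u ⟩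
    w · (q↑ (suc g + 0) · u)
      ≲⟨ ·-monoʳ (G-nonNeg a (c + 0)) (≼-⊞ʳ (G-nonNeg (suc a + d) (g + 0))) ⟩
    w · (q↑ (suc g + 0) · u ⊞ G (suc a + d) (g + 0)) ∎
    where
    open ≼-Reasoning
    x = G a (suc g + (c + 0))
    w = G a (c + 0)
    u = G (a + d) (suc g + 0)
  exchange-high a d (suc b) c g r r≤ = begin
    q↑ (suc g + r) · (x · (q↑ suc b · z₁ ⊞ z₂))
      ≈⟨ solve 5 (λ s x p z₁ z₂ → s :* (x :* (p :* z₁ :+ z₂)) := (s :* p) :* (x :* z₁) :+ s :* (x :* z₂))
           ≈-refl (q↑ (suc g + r)) x (q↑ suc b) z₁ z₂ ⟩
    (q↑ (suc g + r) · q↑ suc b) · (x · z₁) ⊞ q↑ (suc g + r) · (x · z₂)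
      ≈⟨ +-congʳ (*-congʳ (*-congʳ (q↑-+ (suc g) r))) ⟩
    ((q↑ suc g · q↑ r) · q↑ suc b) · (x · z₁) ⊞ q↑ (suc g + r) · (x · z₂)
      ≈⟨ +-congʳ (solve 4 (λ g r p y → ((g :* r) :* p) :* y := (g :* p) :* (r :* y))
           ≈-refl (q↑ suc g) (q↑ r) (q↑ suc b) (x · z₁)) ⟩
    (q↑ suc g · q↑ suc b) · (q↑ r · (x · z₁)) ⊞ q↑ (suc g + r) · (x · z₂)
      ≈⟨ +-congʳ (*-congʳ (≈-sym (q↑-+ (suc g) (suc b)))) ⟩
    p · (q↑ r · (x · z₁)) ⊞ q↑ (suc g + r) · (x · z₂)
      ≲⟨ ⊞-mono (·-monoʳ (q↑-nonNeg (suc g + suc b)) (exchange a d (suc b) c (suc g) r≤)) second ⟩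
    p · (w · u) ⊞ w · v
      ≈⟨ solve 4 (λ p w u v → p :* (w :* u) :+ w :* v := w :* (p :* u :+ v)) ≈-refl p w u v ⟩
    w · (p · u ⊞ v) ∎
    where
    open ≼-Reasoning
    p = q↑ (suc g + suc b)
    x = G a (suc g + (c + suc b))
    z₁ = G (a + d) (suc b)
    z₂ = G (suc a + d) b
    w = G a (c + suc b)
    u = G (a + d) (suc g + suc b)
    v = G (suc a + d) (g + suc b)
    second : q↑ (suc g + r) · (x · z₂) ≼ w · v
    -- Passing from `suc b` to b while raising c keeps both widths that contain c; `suc d * suc g`
    -- leaves room for the exponent `suc g + r`.
    second with ih ← exchange a (suc d) b (suc c) (suc g) (ℕ.+-monoʳ-≤ (suc g) r≤)
      rewrite ℕ.+-suc a d | ℕ.+-suc c b | ℕ.+-suc g b = ih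

  exchange′ a d zero c g {r} r≤ = begin
    q↑ r · (q↑ c · (x · 1#))
      ≈⟨ *-congˡ (*-cong (q↑-cong (sym (ℕ.+-identityʳ c))) (*-congˡ (≈-sym (G-zeroʳ (a + d))))) ⟩
    q↑ r · (q↑ (c + 0) · (x · G (a + d) 0))
      ≈⟨ solve 3 (λ r c y → r :* (c :* y) := c :* (r :* y)) ≈-refl (q↑ r) (q↑ (c + 0)) (x · G (a + d) 0) ⟩
    q↑ (c + 0) · (q↑ r · (x · G (a + d) 0))
      ≲⟨ ·-monoʳ (q↑-nonNeg (c + 0)) (exchange a d 0 c g r≤) ⟩
    q↑ (c + 0) · (G a (c + 0) · u)
      ≈⟨ solve 3 (λ p w u → p :* (w :* u) := (p :* w) :* u) ≈-refl (q↑ (c + 0)) (G a (c + 0)) u ⟩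
    (q↑ (c + 0) · G a (c + 0)) · u
      ≲⟨ ·-monoˡ (G-nonNeg (a + d) (g + 0)) (q↑·G≼G a (c + 0)) ⟩
    G (suc a) (c + 0) · u ∎
    where
    open ≼-Reasoning
    x = G a (g + (c + 0))
    u = G (a + d) (g + 0)
  exchange′ a d (suc b) c g {r} r≤ = begin
    q↑ r · (q↑ c · (x · (q↑ suc b · z₁ ⊞ z₂)))
      ≈⟨ solve 6 (λ r c x p z₁ z₂ → r :* (c :* (x :* (p :* z₁ :+ z₂)))
                   := (c :* p) :* (r :* (x :* z₁)) :+ r :* (c :* (x :* z₂)))
           ≈-refl (q↑ r) (q↑ c) x (q↑ suc b) z₁ z₂ ⟩
    (q↑ c · q↑ suc b) · (q↑ r · (x · z₁)) ⊞ q↑ r · (q↑ c · (x · z₂))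
      ≈⟨ +-congʳ (*-congʳ (≈-sym (q↑-+ c (suc b)))) ⟩
    p · (q↑ r · (x · z₁)) ⊞ q↑ r · (q↑ c · (x · z₂))
      ≲⟨ ⊞-mono (·-monoʳ (q↑-nonNeg (c + suc b)) (exchange a d (suc b) c g r≤)) second ⟩
    p · (w · u) ⊞ v · u
      ≈⟨ solve 4 (λ p w u v → p :* (w :* u) :+ v :* u := (p :* w :+ v) :* u) ≈-refl p w u v ⟩
    (p · w ⊞ v) · u
      ≈⟨ *-congʳ pascal ⟩
    G (suc a) (c + suc b) · u ∎
    where
    open ≼-Reasoning
    p = q↑ (c + suc b)
    x = G a (g + (c + suc b))
    z₁ = G (a + d) (suc b)
    z₂ = G (suc a + d) b
    w = G a (c + suc b)
    v = G (suc a) (c + b)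
    u = G (a + d) (g + suc b)
    second : q↑ r · (q↑ c · (x · z₂)) ≼ v · u
    -- Here g rises as b drops, so the widths of x and u are kept and only that of w shrinks, to
    -- that of v.
    second with ih ← exchange′ a d b c (suc g) (ℕ.≤-trans r≤ (ℕ.*-monoʳ-≤ d (ℕ.n≤1+n g)))
      rewrite ℕ.+-suc c b | ℕ.+-suc g (c + b) | ℕ.+-suc g b = ih
    pascal : p · w ⊞ v ≈ G (suc a) (c + suc b)
    pascal rewrite ℕ.+-suc c b = ≈-refl

  -- The first exchange moves one column (g = 1, d = h + e + 1), the second, on transposed boxes,
  -- moves h rows (g = h, d = e). Their bounds d g add up to the bound on r, which `split-≤`
  -- distributes.
  balance : ∀ a e h j {r} → r ≤ (h + suc e) + e * h →
            q↑ r · (G a (2 + e + j) · G ((h + suc e) + a) j)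
            ≼ G (h + a) (suc e + j) · G (suc e + a) (suc j)
  balance a e h j {r} r≤ with s , t , s+t≡r , s≤ , t≤ ← split-≤ (h + suc e) (e * h) r≤ = begin
    q↑ r · (G a (2 + e + j) · G (h + suc e + a) j)
      ≈⟨ *-cong (≈-trans (q↑-cong (sym s+t≡r)) (≈-trans (q↑-+ s t) (*-comm _ _)))
                (*-congˡ (G-congˡ j (ℕ.+-comm (h + suc e) a))) ⟩
    (q↑ t · q↑ s) · (G a (2 + e + j) · G (a + (h + suc e)) j)
      ≈⟨ *-assoc (q↑ t) (q↑ s) _ ⟩
    q↑ t · (q↑ s · (G a (2 + e + j) · G (a + (h + suc e)) j))
      ≲⟨ ·-monoʳ (q↑-nonNeg t)
           (exchange a (h + suc e) j (suc e) 1 (subst (s ≤_) (sym (ℕ.*-identityʳ _)) s≤)) ⟩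
    q↑ t · (G a (suc e + j) · G (a + (h + suc e)) (suc j))
      ≈⟨ *-congˡ (≈-trans (*-comm _ _) (*-cong
           (≈-trans (G-congˡ (suc j) index₁) (G-sym (h + (suc e + a)) (suc j)))
           (≈-trans (G-sym a (suc e + j)) (G-congˡ a (cong suc (ℕ.+-comm e j)))))) ⟩
    q↑ t · (G (suc j) (h + (suc e + a)) · G (suc j + e) a)
      ≲⟨ exchange (suc j) e a (suc e) h t≤ ⟩
    G (suc j) (suc e + a) · G (suc j + e) (h + a)
      ≈⟨ ≈-trans (*-comm _ _) (*-cong
           (≈-trans (G-congˡ (h + a) (cong suc (ℕ.+-comm j e))) (G-sym (suc e + j) (h + a)))
           (G-sym (suc j) (suc e + a))) ⟩
    G (h + a) (suc e + j) · G (suc e + a) (suc j) ∎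
    where
    open ≼-Reasoning
    index₁ : a + (h + suc e) ≡ h + (suc e + a)
    index₁ = trans (ℕ.+-comm a _) (ℕ.+-assoc h (suc e) a)

  -- Kaplansky numbers and the comparison of their products.

  -- G⁻ a b = [a+b-1, a-1], which is 0 for a = 0.
  G⁻ : ℕ → ℕ → Carrier
  G⁻ zero    b = 0#
  G⁻ (suc a) b = G a b

  -- K_q(m+k, m).  The factor q^0 makes it and kaplansky-dual instances of the
  -- same shape q^i G + q^j G⁻.
  kaplansky : ℕ → ℕ → Carrier
  kaplansky m k = q↑ 0 · G m k ⊞ q↑ (m + k) · G⁻ m k

  kaplansky-dual : ∀ m k → kaplansky m k ≈ q↑ m · G m k ⊞ q↑ 0 · G⁻ m k
  kaplansky-dual zero k = +-congˡ (≈-trans (zeroʳ _) (≈-sym (zeroʳ _)))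
  kaplansky-dual (suc m) k = begin
    q↑ 0 · G (suc m) k ⊞ q↑ (suc m + k) · G m k  ≈⟨ +-congʳ (q↑0· _) ⟩
    G (suc m) k ⊞ q↑ (suc m + k) · G m k         ≈⟨ absorbˡ m k ⟩
    q↑ suc m · G (suc m) k ⊞ G m k               ≈⟨ +-congˡ (≈-sym (q↑0· _)) ⟩
    q↑ suc m · G (suc m) k ⊞ q↑ 0 · G m k        ∎
    where open ≈-Reasoning

  -- The terms of the expanded product carry their own powers of q. Once q^(k+l) is factored out,
  -- the left side keeps q^t with t = r + i + j - k - l.
  shift-powers : ∀ r t i j k l {f g f′ g′} → r + (i + j) ≡ t + (k + l) →
                 q↑ t · (f · g) ≼ f′ · g′ →
                 q↑ r · ((q↑ i · f) · (q↑ j · g)) ≼ (q↑ k · f′) · (q↑ l · g′)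
  shift-powers r t i j k l {f} {g} {f′} {g′} eq f·g≼f′·g′ = begin
    q↑ r · ((q↑ i · f) · (q↑ j · g))
      ≈⟨ solve 5 (λ r i j f g → r :* ((i :* f) :* (j :* g)) := (r :* (i :* j)) :* (f :* g))
           ≈-refl (q↑ r) (q↑ i) (q↑ j) f g ⟩
    (q↑ r · (q↑ i · q↑ j)) · (f · g)
      ≈⟨ *-congʳ (≈-trans (≈-sym (q↑-+³ r i j)) (≈-trans (q↑-cong eq) (q↑-+³ t k l))) ⟩
    (q↑ t · (q↑ k · q↑ l)) · (f · g)
      ≈⟨ solve 4 (λ t k l y → (t :* (k :* l)) :* y := (k :* l) :* (t :* y))
           ≈-refl (q↑ t) (q↑ k) (q↑ l) (f · g) ⟩
    (q↑ k · q↑ l) · (q↑ t · (f · g))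
      ≲⟨ ·-monoʳ (·-nonNeg (q↑-nonNeg k) (q↑-nonNeg l)) f·g≼f′·g′ ⟩
    (q↑ k · q↑ l) · (f′ · g′)
      ≈⟨ solve 4 (λ k l f g → (k :* l) :* (f :* g) := (k :* f) :* (l :* g))
           ≈-refl (q↑ k) (q↑ l) f′ g′ ⟩
    (q↑ k · f′) · (q↑ l · g′) ∎
    where
    open ≼-Reasoning
    q↑-+³ : ∀ m n o → q↑ (m + (n + o)) ≈ q↑ m · (q↑ n · q↑ o)
    q↑-+³ m n o = ≈-trans (q↑-+ m (n + o)) (*-congˡ (q↑-+ n o))

  -- The mixed terms are paired crosswise, f g′ with u′ v and f′ g with u v′, because these are the
  -- pairs that `balance` compares, with h = 0 and h = 2.
  expand-mono : ∀ {s f f′ g g′ u u′ v v′} →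
                s · (f · g) ≼ u · v → s · (f · g′) ≼ u′ · v →
                s · (f′ · g) ≼ u · v′ → s · (f′ · g′) ≼ u′ · v′ →
                s · ((f ⊞ f′) · (g ⊞ g′)) ≼ (u ⊞ u′) · (v ⊞ v′)
  expand-mono {s} {f} {f′} {g} {g′} {u} {u′} {v} {v′} p₁ p₂ p₃ p₄ = begin
    s · ((f ⊞ f′) · (g ⊞ g′))
      ≈⟨ solve 5 (λ s f f′ g g′ → s :* ((f :+ f′) :* (g :+ g′))
           := (s :* (f :* g) :+ s :* (f :* g′)) :+ (s :* (f′ :* g) :+ s :* (f′ :* g′)))
           ≈-refl s f f′ g g′ ⟩
    (s · (f · g) ⊞ s · (f · g′)) ⊞ (s · (f′ · g) ⊞ s · (f′ · g′))
      ≲⟨ ⊞-mono (⊞-mono p₁ p₂) (⊞-mono p₃ p₄) ⟩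
    (u · v ⊞ u′ · v) ⊞ (u · v′ ⊞ u′ · v′)
      ≈⟨ solve 4 (λ u u′ v v′ → (u :* v :+ u′ :* v) :+ (u :* v′ :+ u′ :* v′) := (u :+ u′) :* (v :+ v′))
           ≈-refl u u′ v v′ ⟩
    (u ⊞ u′) · (v ⊞ v′) ∎
    where open ≼-Reasoning

  G⁻-nonNeg : ∀ a b → 0# ≼ G⁻ a b
  G⁻-nonNeg zero    b = ≼-refl
  G⁻-nonNeg (suc a) b = G-nonNeg a b

  annihilated : ∀ {s f g} → 0# ≼ g → s · (0# · f) ≼ g
  annihilated {s} {f} 0≼g = ≼-trans (≼-reflexive (≈-trans (*-congˡ (zeroˡ f)) (zeroʳ s))) 0≼g

  -- For m ≥ 1 this is `balance` at m - 1 with h = 2, and `balance⁻⁻` is the same with h = 1; for m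
  -- = 0 the left side vanishes.
  balance⁻ : ∀ m e j {r} → r ≤ (2 + suc e) + e * 2 →
             q↑ r · (G⁻ m (2 + e + j) · G (2 + e + m) j)
             ≼ G (suc m) (suc e + j) · G (e + m) (suc j)
  balance⁻ zero    e j r≤ = annihilated (·-nonNeg (G-nonNeg 1 (suc e + j)) (G-nonNeg (e + 0) (suc j)))
  balance⁻ (suc m) e j {r} r≤ = subst
    (λ x → q↑ r · (G m (2 + e + j) · G (2 + x) j) ≼ G (2 + m) (suc e + j) · G x (suc j))
    (sym (ℕ.+-suc e m)) (balance m e 2 j r≤)

  balance⁻⁻ : ∀ m e j {r} → r ≤ (1 + suc e) + e * 1 →
              q↑ r · (G⁻ m (2 + e + j) · G (suc e + m) j) ≼ G m (suc e + j) · G (e + m) (suc j)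
  balance⁻⁻ zero    e j r≤ = annihilated (·-nonNeg (G-nonNeg 0 (suc e + j)) (G-nonNeg (e + 0) (suc j)))
  balance⁻⁻ (suc m) e j {r} r≤ = subst
    (λ x → q↑ r · (G m (2 + e + j) · G (suc x) j) ≼ G (suc m) (suc e + j) · G x (suc j))
    (sym (ℕ.+-suc e m)) (balance m e 1 j r≤)

  -- Here m, l, n of the theorem are suc m, suc e + m and 2 + m + e + j.
  kaplansky-balance : ∀ m e j {r} → r ≤ 2 * e + 2 →
    q↑ r · (kaplansky m (2 + e + j) · kaplansky (2 + e + m) j)
    ≼ kaplansky (suc m) (suc e + j) · kaplansky (suc e + m) (suc j)
  kaplansky-balance m e j {r} r≤ with ℕ.≤-total r (suc e)
  -- In this form all four comparisons keep the exponent r. The one with h = 0 allows only e + 1,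
  -- which dictates the case split.
  ... | inj₁ r≤1+e = expand-mono
    (shift-powers r r 0 0 0 0 refl (balance m e 1 j r≤′))
    (shift-powers r r 0 (2 + e + m + j) (suc m + (suc e + j)) 0 (cong (r +_) (n≡ m e j))
      (balance m e 0 j (ℕ.≤-trans r≤1+e (ℕ.m≤m+n _ _))))
    (shift-powers r r (m + (2 + e + j)) 0 0 (suc e + m + suc j) (cong (r +_) (n≡′ m e j))
      (balance⁻ m e j (ℕ.≤-trans r≤1+e (ℕ.≤-trans (ℕ.m≤n+m _ 2) (ℕ.m≤m+n _ _)))))
    (shift-powers r r (m + (2 + e + j)) (2 + e + m + j) (suc m + (suc e + j)) (suc e + m + suc j)
      (cong (r +_) (2n≡ m e j)) (balance⁻⁻ m e j r≤′))
    where
    open ExponentIdentities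
    r≤′ : r ≤ (1 + suc e) + e * 1
    r≤′ = subst (r ≤_) (range₁ e) r≤
  -- In the dual form the exponent of the h = 0 comparison drops to t = r - (e + 1) ≤ e + 1, and
  -- that of the h = 2 comparison grows to r + e + 1 ≤ 3e + 3.
  ... | inj₂ 1+e≤r with t , refl ← ℕ.m≤n⇒∃[o]m+o≡n 1+e≤r = begin
    q↑ r′ · (kaplansky m (2 + e + j) · kaplansky (2 + e + m) j)
      ≈⟨ *-congˡ (*-cong (kaplansky-dual m _) (kaplansky-dual (2 + e + m) j)) ⟩
    q↑ r′ · ((q↑ m · G m (2 + e + j) ⊞ q↑ 0 · G⁻ m (2 + e + j))
             · (q↑ (2 + e + m) · G (2 + e + m) j ⊞ q↑ 0 · G (suc e + m) j))
      ≲⟨ expand-mono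
           (shift-powers r′ r′ m (2 + e + m) (suc m) (suc e + m) (cong (r′ +_) (m+l≡ m e))
             (balance m e 1 j r≤′))
           (shift-powers r′ t m 0 0 (suc e + m) (m-shift t m e)
             (balance m e 0 j (ℕ.≤-trans t≤1+e (ℕ.m≤m+n _ _))))
           (shift-powers r′ (r′ + suc e) 0 (2 + e + m) (suc m) 0 (l-shift r′ m e)
             (balance⁻ m e j (ℕ.≤-trans (ℕ.+-monoˡ-≤ (suc e) r≤) (ℕ.≤-reflexive (range₂ e)))))
           (shift-powers r′ r′ 0 0 0 0 refl (balance⁻⁻ m e j r≤′)) ⟩
    (q↑ suc m · G (suc m) (suc e + j) ⊞ q↑ 0 · G m (suc e + j))
    · (q↑ (suc e + m) · G (suc e + m) (suc j) ⊞ q↑ 0 · G (e + m) (suc j))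
      ≈⟨ *-cong (kaplansky-dual (suc m) _) (kaplansky-dual (suc e + m) (suc j)) ⟨
    kaplansky (suc m) (suc e + j) · kaplansky (suc e + m) (suc j) ∎
    where
    open ≼-Reasoning
    open ExponentIdentities
    r′ = suc e + t
    r≤′ : r′ ≤ (1 + suc e) + e * 1
    r≤′ = subst (r′ ≤_) (range₁ e) r≤
    t≤1+e : t ≤ suc e
    t≤1+e = ℕ.+-cancelˡ-≤ (suc e) _ _ (subst (r′ ≤_) (range₀ e) r≤)

-- The commutative ring of formal power series.

infix 4 _≈_ _≼_
infixl 6 _⊕_
infix 8 ⊝_

-- Records rather than plain pointwise statements, so that unification can read
-- the two series off the relation.
record _≈_ (f g : Series) : Set where
  constructor coeffwise
  field coeff : ∀ i → f i ≡ g i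
open _≈_ public

record _≼_ (f g : Series) : Set where
  constructor coeffwise
  field coeff : ∀ i → f i ℤ.≤ g i
open _≼_ public renaming (coeff to coeff≤)

𝟘 : Series
𝟘 _ = 0ℤ

_⊕_ : Series → Series → Series
(f ⊕ g) i = f i ℤ.+ g i

⊝_ : Series → Series
(⊝ f) i = ℤ.- f i

tail : Series → Series
tail f i = f (suc i)

-- (f ⊗ g) (suc i) is definitionally f 0 * g (suc i) + (tail f ⊗ g) i, so the ring
-- laws are proved by induction on the index of the coefficient.
⊗-cong-coeff : ∀ {f f′ g g′} → (∀ i → f i ≡ f′ i) → (∀ i → g i ≡ g′ i) →
               ∀ i → (f ⊗ g) i ≡ (f′ ⊗ g′) i
⊗-cong-coeff p r zero    = cong₂ (λ a b → a ℤ.* b ℤ.+ 0ℤ) (p 0) (r 0)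
⊗-cong-coeff p r (suc i) =
  cong₂ ℤ._+_ (cong₂ ℤ._*_ (p 0) (r (suc i))) (⊗-cong-coeff (p ∘ suc) r i)

⊗-distribʳ-coeff : ∀ f g h i → ((f ⊕ g) ⊗ h) i ≡ ((f ⊗ h) ⊕ (g ⊗ h)) i
⊗-distribʳ-coeff f g h zero =
  solve 3 (λ a b c → (a :+ b) :* c :+ con 0ℤ := a :* c :+ con 0ℤ :+ (b :* c :+ con 0ℤ))
    refl (f 0) (g 0) (h 0)
  where open ℤ-Solver
⊗-distribʳ-coeff f g h (suc i) = trans
  (cong (ℤ._+_ ((f 0 ℤ.+ g 0) ℤ.* h (suc i))) (⊗-distribʳ-coeff (tail f) (tail g) h i))
  (solve 5 (λ a b c x y → (a :+ b) :* c :+ (x :+ y) := a :* c :+ x :+ (b :* c :+ y))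
    refl (f 0) (g 0) (h (suc i)) ((tail f ⊗ h) i) ((tail g ⊗ h) i))
  where open ℤ-Solver

-- The convolution unfolds at its first term. Peeling off the last one instead is what lets
-- commutativity go by induction.
⊗-last : ∀ f g i → (f ⊗ g) (suc i) ≡ (f ⊗ tail g) i ℤ.+ f (suc i) ℤ.* g 0
⊗-last f g zero =
  solve 4 (λ a b c d → a :* b :+ (c :* d :+ con 0ℤ) := a :* b :+ con 0ℤ :+ c :* d)
    refl (f 0) (g 1) (f 1) (g 0)
  where open ℤ-Solver
⊗-last f g (suc i) = trans
  (cong (ℤ._+_ (f 0 ℤ.* g (suc (suc i)))) (⊗-last (tail f) g i))
  (sym (ℤ.+-assoc (f 0 ℤ.* g (suc (suc i))) _ _))

⊗-comm-coeff : ∀ f g i → (f ⊗ g) i ≡ (g ⊗ f) i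
⊗-comm-coeff f g zero    = cong (ℤ._+ 0ℤ) (ℤ.*-comm (f 0) (g 0))
⊗-comm-coeff f g (suc i) = begin
  f 0 ℤ.* g (suc i) ℤ.+ (tail f ⊗ g) i
    ≡⟨ cong₂ ℤ._+_ (ℤ.*-comm (f 0) (g (suc i))) (⊗-comm-coeff (tail f) g i) ⟩
  g (suc i) ℤ.* f 0 ℤ.+ (g ⊗ tail f) i
    ≡⟨ ℤ.+-comm (g (suc i) ℤ.* f 0) _ ⟩
  (g ⊗ tail f) i ℤ.+ g (suc i) ℤ.* f 0
    ≡⟨ ⊗-last g f i ⟨
  (g ⊗ f) (suc i) ∎
  where open ≡-Reasoning

⊗-scaleˡ : ∀ c f g i → ((λ j → c ℤ.* f j) ⊗ g) i ≡ c ℤ.* (f ⊗ g) i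
⊗-scaleˡ c f g zero =
  solve 3 (λ a b d → a :* b :* d :+ con 0ℤ := a :* (b :* d :+ con 0ℤ)) refl c (f 0) (g 0)
  where open ℤ-Solver
⊗-scaleˡ c f g (suc i) = trans
  (cong (ℤ._+_ (c ℤ.* f 0 ℤ.* g (suc i))) (⊗-scaleˡ c (tail f) g i))
  (solve 4 (λ a b d x → a :* b :* d :+ a :* x := a :* (b :* d :+ x))
    refl c (f 0) (g (suc i)) ((tail f ⊗ g) i))
  where open ℤ-Solver

⊗-assoc-coeff : ∀ f g h i → ((f ⊗ g) ⊗ h) i ≡ (f ⊗ (g ⊗ h)) i
⊗-assoc-coeff f g h zero =
  solve 3 (λ a b c → (a :* b :+ con 0ℤ) :* c :+ con 0ℤ := a :* (b :* c :+ con 0ℤ) :+ con 0ℤ)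
    refl (f 0) (g 0) (h 0)
  where open ℤ-Solver
⊗-assoc-coeff f g h (suc i) = begin
  -- `tail (f ⊗ g)` is by definition `f 0` times `tail g` plus `tail f ⊗ g`.
  (f 0 ℤ.* g 0 ℤ.+ 0ℤ) ℤ.* h (suc i) ℤ.+ (((λ j → f 0 ℤ.* tail g j) ⊕ (tail f ⊗ g)) ⊗ h) i
    ≡⟨ cong (ℤ._+_ ((f 0 ℤ.* g 0 ℤ.+ 0ℤ) ℤ.* h (suc i)))
         (trans (⊗-distribʳ-coeff (λ j → f 0 ℤ.* tail g j) (tail f ⊗ g) h i)
                (cong₂ ℤ._+_ (⊗-scaleˡ (f 0) (tail g) h i) (⊗-assoc-coeff (tail f) g h i))) ⟩
  (f 0 ℤ.* g 0 ℤ.+ 0ℤ) ℤ.* h (suc i) ℤ.+ (f 0 ℤ.* (tail g ⊗ h) i ℤ.+ (tail f ⊗ (g ⊗ h)) i)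
    ≡⟨ solve 5 (λ a b c x y → (a :* b :+ con 0ℤ) :* c :+ (a :* x :+ y) := a :* (b :* c :+ x) :+ y)
         refl (f 0) (g 0) (h (suc i)) ((tail g ⊗ h) i) ((tail f ⊗ (g ⊗ h)) i) ⟩
  f 0 ℤ.* (g 0 ℤ.* h (suc i) ℤ.+ (tail g ⊗ h) i) ℤ.+ (tail f ⊗ (g ⊗ h)) i ∎
  where
  open ≡-Reasoning
  open ℤ-Solver

⊗-zeroˡ-coeff : ∀ f i → (𝟘 ⊗ f) i ≡ 0ℤ
⊗-zeroˡ-coeff f zero    = refl
⊗-zeroˡ-coeff f (suc i) = trans (ℤ.+-identityˡ _) (⊗-zeroˡ-coeff f i)

⊗-identityˡ-coeff : ∀ f i → (𝟙 ⊗ f) i ≡ f i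
⊗-identityˡ-coeff f zero    = trans (ℤ.+-identityʳ _) (ℤ.*-identityˡ (f 0))
⊗-identityˡ-coeff f (suc i) = trans
  (cong₂ ℤ._+_ (ℤ.*-identityˡ (f (suc i))) (⊗-zeroˡ-coeff f i))
  (ℤ.+-identityʳ _)

≈-isEquivalence : IsEquivalence _≈_
≈-isEquivalence = record
  { refl  = coeffwise λ _ → refl
  ; sym   = λ p → coeffwise λ i → sym (coeff p i)
  ; trans = λ p r → coeffwise λ i → trans (coeff p i) (coeff r i)
  }

⊕-cong : ∀ {f f′ g g′} → f ≈ f′ → g ≈ g′ → f ⊕ g ≈ f′ ⊕ g′
⊕-cong p r = coeffwise λ i → cong₂ ℤ._+_ (coeff p i) (coeff r i)

⊗-cong : ∀ {f f′ g g′} → f ≈ f′ → g ≈ g′ → f ⊗ g ≈ f′ ⊗ g′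
⊗-cong p r = coeffwise (⊗-cong-coeff (coeff p) (coeff r))

⊗-comm : ∀ f g → f ⊗ g ≈ g ⊗ f
⊗-comm f g = coeffwise (⊗-comm-coeff f g)

⊗-identityˡ : ∀ f → 𝟙 ⊗ f ≈ f
⊗-identityˡ f = coeffwise (⊗-identityˡ-coeff f)

⊗-distribʳ : ∀ h f g → (f ⊕ g) ⊗ h ≈ f ⊗ h ⊕ g ⊗ h
⊗-distribʳ h f g = coeffwise (⊗-distribʳ-coeff f g h)

seriesSetoid : Setoid _ _
seriesSetoid = record { isEquivalence = ≈-isEquivalence }

seriesRing : CommutativeRing _ _
seriesRing = record
  { Carrier = Series
  ; _≈_ = _≈_
  ; _+_ = _⊕_
  ; _*_ = _⊗_
  ; -_ = ⊝_
  ; 0# = 𝟘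
  ; 1# = 𝟙
  ; isCommutativeRing = record
    { isRing = record
      { +-isAbelianGroup = record
        { isGroup = record
          { isMonoid = record
            { isSemigroup = record
              { isMagma = record
                { isEquivalence = ≈-isEquivalence
                ; ∙-cong = ⊕-cong
                }
              ; assoc = λ f g h → coeffwise λ i → ℤ.+-assoc (f i) (g i) (h i)
              }
            ; identity = (λ f → coeffwise λ i → ℤ.+-identityˡ (f i))
                       , (λ f → coeffwise λ i → ℤ.+-identityʳ (f i))
            }
          ; inverse = (λ f → coeffwise λ i → ℤ.+-inverseˡ (f i))
                    , (λ f → coeffwise λ i → ℤ.+-inverseʳ (f i))
          ; ⁻¹-cong = λ p → coeffwise λ i → cong ℤ.-_ (coeff p i)
          }
        ; comm = λ f g → coeffwise λ i → ℤ.+-comm (f i) (g i)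
        }
      ; *-cong = ⊗-cong
      ; *-assoc = λ f g h → coeffwise (⊗-assoc-coeff f g h)
      ; *-identity = comm∧idˡ⇒id ⊗-comm ⊗-identityˡ
      ; distrib = comm∧distrʳ⇒distr ⊕-cong ⊗-comm ⊗-distribʳ
      }
    ; *-comm = ⊗-comm
    }
  }
  where
  open Consequences seriesSetoid
    using (comm∧idˡ⇒id; comm∧distrʳ⇒distr)

module R = CommutativeRing seriesRing

-- The coefficientwise order.

≼-preorder : Preorder _ _ _
≼-preorder = record
  { Carrier = Series
  ; _≈_ = _≈_
  ; _≲_ = _≼_
  ; isPreorder = record
    { isEquivalence = ≈-isEquivalence
    ; reflexive = λ p → coeffwise λ i → ℤ.≤-reflexive (coeff p i)
    ; trans = λ p r → coeffwise λ i → ℤ.≤-trans (coeff≤ p i) (coeff≤ r i)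
    }
  }

module ≼ = Preorder ≼-preorder
⊕-mono : ∀ {f f′ g g′} → f ≼ f′ → g ≼ g′ → f ⊕ g ≼ f′ ⊕ g′
⊕-mono p r = coeffwise λ i → ℤ.+-mono-≤ (coeff≤ p i) (coeff≤ r i)

⊗-nonNeg : ∀ {f g} → 𝟘 ≼ f → 𝟘 ≼ g → 𝟘 ≼ f ⊗ g
⊗-nonNeg p r = coeffwise (go (coeff≤ p) (coeff≤ r))
  where
  *-nonNeg : ∀ {a b} → 0ℤ ℤ.≤ a → 0ℤ ℤ.≤ b → 0ℤ ℤ.≤ a ℤ.* b
  *-nonNeg {a} {b} 0≤a 0≤b =
    subst (ℤ._≤ a ℤ.* b) (ℤ.*-zeroʳ a) (ℤ.*-monoˡ-≤-nonNeg a {{ℤ.nonNegative 0≤a}} 0≤b)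

  go : ∀ {f g} → (∀ i → 0ℤ ℤ.≤ f i) → (∀ i → 0ℤ ℤ.≤ g i) → ∀ i → 0ℤ ℤ.≤ (f ⊗ g) i
  go p r zero    = ℤ.+-mono-≤ (*-nonNeg (p 0) (r 0)) ℤ.≤-refl
  go p r (suc i) = ℤ.+-mono-≤ (*-nonNeg (p 0) (r (suc i))) (go (p ∘ suc) r i)

open RingProperties R.ring using (x[y-z]≈xy-xz; [y-z]x≈yx-zx)

≼⇒nonNeg-⊖ : ∀ {f g} → f ≼ g → 𝟘 ≼ g ⊖ f
≼⇒nonNeg-⊖ p = coeffwise λ i → ℤ.i≤j⇒0≤j-i (coeff≤ p i)

nonNeg-⊖⇒≼ : ∀ {f g} → 𝟘 ≼ g ⊖ f → f ≼ g
nonNeg-⊖⇒≼ p = coeffwise λ i → ℤ.0≤i-j⇒j≤i (coeff≤ p i)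

-- `_⊖_` unfolds to the subtraction of the ring, so distributivity reduces this to the nonnegativity
-- of x ⊗ (g ⊖ f).
⊗-monoʳ : ∀ {x f g} → 𝟘 ≼ x → f ≼ g → x ⊗ f ≼ x ⊗ g
⊗-monoʳ {x} {f} {g} 0≼x f≼g = nonNeg-⊖⇒≼
  (≼.trans (⊗-nonNeg 0≼x (≼⇒nonNeg-⊖ f≼g)) (≼.reflexive (x[y-z]≈xy-xz x g f)))

-- Powers of q and the geometric series.

q^-nonNeg : ∀ k → 𝟘 ≼ q^ k
q^-nonNeg k = coeffwise (go k)
  where
  go : ∀ k i → 0ℤ ℤ.≤ (q^ k) i
  go zero    zero    = +≤+ z≤n
  go zero    (suc i) = +≤+ z≤n
  go (suc k) zero    = +≤+ z≤n
  go (suc k) (suc i) = go k i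

-- `q^ (suc k)` has head 0 and its tail computes to `q^ k`, so each step of the induction removes
-- one factor q.
q^-shift-< : ∀ k f {i} → i < k → (q^ k ⊗ f) i ≡ 0ℤ
q^-shift-< (suc k) f {zero}  _         = refl
q^-shift-< (suc k) f {suc i} (s<s i<k) =
  trans (ℤ.+-identityˡ _) (q^-shift-< k f i<k)

q^-shift : ∀ k f i → (q^ k ⊗ f) (k + i) ≡ f i
q^-shift zero    f i = coeff (R.*-identityˡ f) i
q^-shift (suc k) f i = trans (ℤ.+-identityˡ _) (q^-shift k f i)

q^-+ : ∀ m n → q^ (m + n) ≈ q^ m ⊗ q^ n
q^-+ m n = coeffwise (go m)
  where
  go : ∀ m i → (q^ (m + n)) i ≡ (q^ m ⊗ q^ n) i
  go zero    i       = sym (coeff (R.*-identityˡ (q^ n)) i)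
  go (suc m) zero    = refl
  go (suc m) (suc i) = trans (go m i) (sym (ℤ.+-identityˡ _))

1-q^-⊗ : ∀ k f → (1-q^ k) ⊗ f ≈ f ⊖ q^ k ⊗ f
1-q^-⊗ k f = R.trans ([y-z]x≈yx-zx f 𝟙 (q^ k))
  (R.+-congʳ (R.*-identityˡ f))

-- The coefficients of the geometric series have period k, so the product telescopes from k on;
-- below k only the index 0 is divisible by k.
inverseʳ : ∀ k .{{_ : NonZero k}} → (1-q^ k) ⊗ [1-q^ k ]⁻¹ ≈ 𝟙
inverseʳ k = R.trans (1-q^-⊗ k _) (coeffwise go)
  where
  inv = [1-q^ k ]⁻¹
  below : ∀ i → i < k → inv i ≡ 𝟙 i
  below zero    _   = cong (if_then 1ℤ else 0ℤ) (dec-true (k ∣? 0) (k ∣0))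
  below (suc i) i<k = cong (if_then 1ℤ else 0ℤ) (dec-false (k ∣? suc i) (ℕ.<⇒≱ i<k ∘ ∣⇒≤))
  periodic : ∀ i → inv (k + i) ≡ inv i
  periodic i = cong (if_then 1ℤ else 0ℤ) $
    does-⇔ (mk⇔ (λ k∣k+i → ∣m+n∣m⇒∣n k∣k+i ∣-refl) (∣m∣n⇒∣m+n ∣-refl)) (k ∣? (k + i)) (k ∣? i)
  𝟙-above : ∀ k i .{{_ : NonZero k}} → 𝟙 (k + i) ≡ 0ℤ
  𝟙-above (suc k) i = refl
  go : ∀ i → (inv ⊖ q^ k ⊗ inv) i ≡ 𝟙 i
  go i with i ℕ.<? k
  ... | yes i<k = trans (cong₂ ℤ._-_ (below i i<k) (q^-shift-< k inv i<k)) (ℤ.+-identityʳ _)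
  ... | no  i≮k with j , refl ← ℕ.m≤n⇒∃[o]m+o≡n (ℕ.≮⇒≥ i≮k) =
    trans (cong₂ ℤ._-_ (periodic j) (q^-shift k inv j))
          (trans (ℤ.+-inverseʳ (inv j)) (sym (𝟙-above k j)))

-- Closure properties of polynomials.

-- Unlike the strict bound of `IsPolynomial`, d = 0 here means the zero series, where the induction
-- of `⊗-vanishes` starts.
Vanishes≥ : ℕ → Series → Set
Vanishes≥ d f = ∀ i → d ≤ i → f i ≡ 0ℤ

⊗-vanishes : ∀ {f g} d e → Vanishes≥ d f → Vanishes≥ e g → Vanishes≥ (d + e) (f ⊗ g)
⊗-vanishes {f} {g} zero e p r i _ =
  trans (⊗-cong-coeff {f} {𝟘} {g} (λ j → p j z≤n) (λ _ → refl) i) (coeff (R.zeroˡ g) i)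
⊗-vanishes {f} {g} (suc d) e p r (suc i) (s≤s d+e≤i) =
  cong₂ ℤ._+_
    (trans (cong (f 0 ℤ.*_) (r (suc i) (ℕ.≤-trans (ℕ.m≤n+m e d) (ℕ.m≤n⇒m≤1+n d+e≤i)))) (ℤ.*-zeroʳ (f 0)))
    (⊗-vanishes d e (λ j d≤j → p (suc j) (s≤s d≤j)) r i d+e≤i)

≈-isPolynomial : ∀ {f g} → f ≈ g → IsPolynomial g → IsPolynomial f
≈-isPolynomial p (d , v) = d , λ i d<i → trans (coeff p i) (v i d<i)

⊗-isPolynomial : ∀ f g → IsPolynomial f → IsPolynomial g → IsPolynomial (f ⊗ g)
⊗-isPolynomial f g (d , v) (e , w) = suc d + suc e , λ i d+e<i →
  ⊗-vanishes {f} {g} (suc d) (suc e) v w i (ℕ.<⇒≤ d+e<i)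

-- The operation is arbitrary so as to cover both sums and differences.
pointwise-isPolynomial : ∀ (_∙_ : ℤ → ℤ → ℤ) → 0ℤ ∙ 0ℤ ≡ 0ℤ → ∀ f g →
                         IsPolynomial f → IsPolynomial g → IsPolynomial (λ i → f i ∙ g i)
pointwise-isPolynomial _∙_ 0∙0 f g (d , v) (e , w) = d + e , λ i d+e<i → trans
  (cong₂ _∙_ (v i (ℕ.≤-<-trans (ℕ.m≤m+n d e) d+e<i)) (w i (ℕ.≤-<-trans (ℕ.m≤n+m e d) d+e<i))) 0∙0

q^-isPolynomial : ∀ k → IsPolynomial (q^ k)
q^-isPolynomial k = k , go k
  where
  go : ∀ k i → k < i → (q^ k) i ≡ 0ℤ
  go zero    (suc i) _         = refl
  go (suc k) (suc i) (s<s k<i) = go k i k<i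

seriesWithPowers : OrderedRingWithPowers
seriesWithPowers = record
  { commutativeRing = seriesRing
  ; _≼_             = _≼_
  ; ≼-isPreorder    = ≼.isPreorder
  ; ⊞-mono          = ⊕-mono
  ; ·-monoʳ         = ⊗-monoʳ
  ; q↑_             = q^_
  ; q↑-zero         = R.refl
  ; q↑-+            = q^-+
  ; q↑-nonNeg       = q^-nonNeg
  }

open Gaussian seriesWithPowers
  using (G; G⁻; absorbˡ; kaplansky; kaplansky-dual; kaplansky-balance; module ≈-Reasoning)

G-isPolynomial : ∀ a b → IsPolynomial (G a b)
G-isPolynomial zero    b       = q^-isPolynomial 0
G-isPolynomial (suc a) zero    = q^-isPolynomial 0
G-isPolynomial (suc a) (suc b) =
  pointwise-isPolynomial ℤ._+_ refl (q^ (suc b) ⊗ G a (suc b)) (G (suc a) b)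
    (⊗-isPolynomial (q^ (suc b)) (G a (suc b)) (q^-isPolynomial (suc b)) (G-isPolynomial a (suc b)))
    (G-isPolynomial (suc a) b)

G⁻-isPolynomial : ∀ a b → IsPolynomial (G⁻ a b)
G⁻-isPolynomial zero    b = 0 , λ _ _ → refl
G⁻-isPolynomial (suc a) b = G-isPolynomial a b

kaplansky-isPolynomial : ∀ m k → IsPolynomial (kaplansky m k)
kaplansky-isPolynomial m k =
  pointwise-isPolynomial ℤ._+_ refl (q^ 0 ⊗ G m k) (q^ (m + k) ⊗ G⁻ m k)
    (⊗-isPolynomial (q^ 0) (G m k) (q^-isPolynomial 0) (G-isPolynomial m k))
    (⊗-isPolynomial (q^ (m + k)) (G⁻ m k) (q^-isPolynomial (m + k)) (G⁻-isPolynomial m k))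

-- Agreement of the quotient formulas with the recursion.

x⊕y≈z⊕w⇒w⊖y≈x⊖z : ∀ x y z w → x ⊕ y ≈ z ⊕ w → w ⊖ y ≈ x ⊖ z
x⊕y≈z⊕w⇒w⊖y≈x⊖z x y z w eq = coeffwise λ i → begin
  w i ℤ.- y i                          ≡⟨ solve 3 (λ y z w → w :- y := (z :+ w) :- (y :+ z)) refl (y i) (z i) (w i) ⟩
  (z i ℤ.+ w i) ℤ.- (y i ℤ.+ z i)      ≡⟨ cong (ℤ._- (y i ℤ.+ z i)) (coeff eq i) ⟨
  (x i ℤ.+ y i) ℤ.- (y i ℤ.+ z i)      ≡⟨ solve 3 (λ x y z → (x :+ y) :- (y :+ z) := x :- z) refl (x i) (y i) (z i) ⟩
  x i ℤ.- z i                          ∎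
  where
  open ≡-Reasoning
  open ℤ-Solver

1-q^-absorb : ∀ m k → (1-q^ (suc m + k)) ⊗ G m k ≈ (1-q^ (suc m)) ⊗ G (suc m) k
1-q^-absorb m k = begin
  (1-q^ (suc m + k)) ⊗ G m k                   ≈⟨ 1-q^-⊗ (suc m + k) (G m k) ⟩
  G m k ⊖ q^ (suc m + k) ⊗ G m k               ≈⟨ x⊕y≈z⊕w⇒w⊖y≈x⊖z (G (suc m) k) _ _ (G m k) (absorbˡ m k) ⟩
  G (suc m) k ⊖ q^ (suc m) ⊗ G (suc m) k       ≈⟨ 1-q^-⊗ (suc m) (G (suc m) k) ⟨
  (1-q^ (suc m)) ⊗ G (suc m) k                 ∎
  where open ≈-Reasoning

-- Clears the denominator of an expression of the shape shared by `Kq` and the unfolded `gaussian`.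
divide : ∀ k .{{_ : NonZero k}} x f g → x ⊗ f ≈ (1-q^ k) ⊗ g → x ⊗ [1-q^ k ]⁻¹ ⊗ f ≈ g
divide k x f g eq = begin
  x ⊗ inv ⊗ f              ≈⟨ ⊗-cong (R.*-comm x inv) (R.refl {f}) ⟩
  inv ⊗ x ⊗ f              ≈⟨ R.*-assoc inv x f ⟩
  inv ⊗ (x ⊗ f)            ≈⟨ ⊗-cong (R.refl {inv}) eq ⟩
  inv ⊗ ((1-q^ k) ⊗ g)     ≈⟨ R.*-assoc inv (1-q^ k) g ⟨
  inv ⊗ (1-q^ k) ⊗ g       ≈⟨ ⊗-cong (R.trans (R.*-comm inv (1-q^ k)) (inverseʳ k)) (R.refl {g}) ⟩
  𝟙 ⊗ g                    ≈⟨ R.*-identityˡ g ⟩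
  g                        ∎
  where
  open ≈-Reasoning
  inv = [1-q^ k ]⁻¹

-- The factor i = 0 of the product is (1 - q^(m+1+k)) / (1 - q^(m+1)); in the others the successors
-- cancel, leaving `gaussian (m + k) m`.
gaussian≈G : ∀ m k → gaussian (m + k) m ≈ G m k
gaussian≈G zero    k = R.refl
gaussian≈G (suc m) k = divide (suc m) (1-q^ (suc m + k)) (gaussian (m + k) m) (G (suc m) k)
  (R.trans (⊗-cong (R.refl {1-q^ (suc m + k)}) (gaussian≈G m k)) (1-q^-absorb m k))

-- Subtracting q^n times the second form of the Kaplansky number from the
-- first makes the G⁻ terms cancel.
1-q^-kaplansky : ∀ m k → (1-q^ (m + k + m)) ⊗ G m k ≈ (1-q^ (m + k)) ⊗ kaplansky m k
1-q^-kaplansky m k = begin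
  (1-q^ (m + k + m)) ⊗ g             ≈⟨ 1-q^-⊗ (m + k + m) g ⟩
  g ⊖ q^ (m + k + m) ⊗ g             ≈⟨ x⊕y≈z⊕w⇒w⊖y≈x⊖z K (q^ (m + k + m) ⊗ g) (u ⊗ K) g moved ⟩
  K ⊖ u ⊗ K                          ≈⟨ 1-q^-⊗ (m + k) K ⟨
  (1-q^ (m + k)) ⊗ K                 ∎
  where
  open ≈-Reasoning
  g = G m k
  g⁻ = G⁻ m k
  K = kaplansky m k
  u = q^ (m + k)
  v = q^ m
  moved : K ⊕ q^ (m + k + m) ⊗ g ≈ u ⊗ K ⊕ g
  moved = begin
    (𝟙 ⊗ g ⊕ u ⊗ g⁻) ⊕ q^ (m + k + m) ⊗ g
      ≈⟨ ⊕-cong (R.refl {𝟙 ⊗ g ⊕ u ⊗ g⁻}) (⊗-cong (q^-+ (m + k) m) (R.refl {g})) ⟩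
    (𝟙 ⊗ g ⊕ u ⊗ g⁻) ⊕ (u ⊗ v) ⊗ g
      ≈⟨ solve 4 (λ g g⁻ u v → (con 1 :* g :+ u :* g⁻) :+ (u :* v) :* g
           := u :* (v :* g :+ con 1 :* g⁻) :+ g) R.refl g g⁻ u v ⟩
    u ⊗ (v ⊗ g ⊕ 𝟙 ⊗ g⁻) ⊕ g
      ≈⟨ ⊕-cong (⊗-cong (R.refl {u}) (kaplansky-dual m k)) (R.refl {g}) ⟨
    u ⊗ K ⊕ g ∎
    where open SemiringSolver R.commutativeSemiring

-- The indices enter through equations so that all four Kaplansky numbers can share one n while
-- `m′ + k` varies in form.
Kq≈kaplansky : ∀ n .{{_ : NonZero n}} m {m′} k → m ≡ m′ → m′ + k ≡ n → Kq n m ≈ kaplansky m′ k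
Kq≈kaplansky _ m k refl refl = divide (m + k) (1-q^ (m + k + m)) (gaussian (m + k) m) (kaplansky m k)
  (R.trans (⊗-cong (R.refl {1-q^ (m + k + m)}) (gaussian≈G m k)) (1-q^-kaplansky m k))

theorem1p2 : ∀ (n m l r : ℕ) .{{_ : NonZero n}} →
    1 ≤ m → m ≤ l → l < n → r ≤ 2 * l ∸ 2 * m + 2 →
    IsNonNegPolynomial
    (Kq n m ⊗ Kq n l ⊖ (q^ r) ⊗ Kq n (m ∸ 1) ⊗ Kq n (l + 1))
theorem1p2 n (suc m) l r _ m≤l l<n r≤
  -- In the variables of the theorem, e = l - m and j = n - l - 1; the matched `suc m` makes the
  -- lower index m - 1 the new m.
  with e , refl ← ℕ.m≤n⇒∃[o]m+o≡n m≤l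
  with j , refl ← ℕ.m≤n⇒∃[o]m+o≡n l<n =
  pointwise-isPolynomial ℤ._-_ refl A B A-isPolynomial B-isPolynomial ,
  coeff≤ A⊖B-nonNeg
  where
  N = 2 + m + e + j
  K₁ = kaplansky (suc m) (suc e + j)
  K₂ = kaplansky (suc e + m) (suc j)
  K₃ = kaplansky m (2 + e + j)
  K₄ = kaplansky (2 + e + m) j
  A = Kq N (suc m) ⊗ Kq N (suc m + e)
  B = q^ r ⊗ Kq N m ⊗ Kq N (suc m + e + 1)

  open ℕ-Solver

  Kq≈K₁ : Kq N (suc m) ≈ K₁
  Kq≈K₁ = Kq≈kaplansky N (suc m) (suc e + j) refl
    (solve 3 (λ m e j → con 1 :+ m :+ (con 1 :+ e :+ j) := con 2 :+ m :+ e :+ j) refl m e j)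

  Kq≈K₂ : Kq N (suc m + e) ≈ K₂
  Kq≈K₂ = Kq≈kaplansky N (suc m + e) (suc j) (cong suc (ℕ.+-comm m e))
    (solve 3 (λ m e j → con 1 :+ e :+ m :+ (con 1 :+ j) := con 2 :+ m :+ e :+ j) refl m e j)

  Kq≈K₃ : Kq N m ≈ K₃
  Kq≈K₃ = Kq≈kaplansky N m (2 + e + j) refl
    (solve 3 (λ m e j → m :+ (con 2 :+ e :+ j) := con 2 :+ m :+ e :+ j) refl m e j)

  Kq≈K₄ : Kq N (suc m + e + 1) ≈ K₄
  Kq≈K₄ = Kq≈kaplansky N (suc m + e + 1) j
    (solve 2 (λ m e → con 1 :+ m :+ e :+ con 1 := con 2 :+ e :+ m) refl m e)
    (solve 3 (λ m e j → con 2 :+ e :+ m :+ j := con 2 :+ m :+ e :+ j) refl m e j)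

  first : A ≈ K₁ ⊗ K₂
  first = ⊗-cong Kq≈K₁ Kq≈K₂

  second : B ≈ q^ r ⊗ (K₃ ⊗ K₄)
  second = begin
    q^ r ⊗ Kq N m ⊗ Kq N (suc m + e + 1)    ≈⟨ R.*-assoc (q^ r) (Kq N m) (Kq N (suc m + e + 1)) ⟩
    q^ r ⊗ (Kq N m ⊗ Kq N (suc m + e + 1))  ≈⟨ ⊗-cong (R.refl {q^ r}) (⊗-cong Kq≈K₃ Kq≈K₄) ⟩
    q^ r ⊗ (K₃ ⊗ K₄)                        ∎
    where open ≈-Reasoning

  A-isPolynomial : IsPolynomial A
  A-isPolynomial = ≈-isPolynomial first (⊗-isPolynomial K₁ K₂
    (kaplansky-isPolynomial (suc m) (suc e + j)) (kaplansky-isPolynomial (suc e + m) (suc j)))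

  B-isPolynomial : IsPolynomial B
  B-isPolynomial = ≈-isPolynomial second (⊗-isPolynomial (q^ r) (K₃ ⊗ K₄) (q^-isPolynomial r)
    (⊗-isPolynomial K₃ K₄
      (kaplansky-isPolynomial m (2 + e + j)) (kaplansky-isPolynomial (2 + e + m) j)))

  r≤2e+2 : r ≤ 2 * e + 2
  -- As l is m + e, the truncated difference of 2l and 2m is exactly 2e.
  r≤2e+2 = subst (λ x → r ≤ x + 2)
    (trans (cong (_∸ 2 * suc m) (ℕ.*-distribˡ-+ 2 (suc m) e)) (ℕ.m+n∸m≡n (2 * suc m) (2 * e))) r≤

  difference : B ≼ A
  difference = ≼.trans (≼.reflexive second)
    (≼.trans (kaplansky-balance m e j r≤2e+2) (≼.reflexive (R.sym first)))

  A⊖B-nonNeg : 𝟘 ≼ A ⊖ B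
  A⊖B-nonNeg = ≼⇒nonNeg-⊖ difference
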